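{- Let $n,k$ be positive integers and let $\mathcal{F}\subseteq[n]^{(k)}$ be intersecting. Then there are sets $M_1\subseteq M_2\subseteq\dots\subseteq M_k\subseteq[n]$ with $\vert M_i\vert\geq n-\sum_{j=i}^{k}j$ for each $i\in[k]$, such that for every $i\in[k]$ and every $A\in M_i^{(i)}$, the family $\mathcal{F}(A)$ is pseudo-intersecting.
   Context: $[n]=\{1,\dots,n\}$ and $X^{(k)}$ denotes the set of $k$-element subsets of $X$. A family $\mathcal{F}$ is intersecting if $F\cap F'\neq\emptyset$ for all $F,F'\in\mathcal{F}$. The shadow of a family $\mathcal{H}$ of sets is $\partial\mathcal{H}=\{H\setminus\{x\}: x\in H\in\mathcal{H}\}$. For $A,B\subseteq[n]$, $\mathcal{F}(A,\overline{B})=\{F\setminus A: F\in\mathcal{F},\ A\subseteq F,\ B\cap F=\emptyset\}$, $\mathcal{F}(A)=\mathcal{F}(A,\overline{\emptyset})$ and $\mathcal{F}(\overline{B})=\mathcal{F}(\emptyset,\overline{B})$. A family $\mathcal{H}$ of subsets of $[n]$ is pseudo-intersecting if $\vert\partial(\mathcal{H}(\overline{X}))\vert\geq\vert\mathcal{H}(\overline{X})\vert$ for all $X\subseteq[n]$, where $\mathcal{H}(\overline{X})=\{H\in\mathcal{H}: H\cap X=\emptyset\}$. (Thus $\mathcal{F}(A)$ is pseudo-intersecting iff $\vert\partial(\mathcal{F}(A,\overline{X\setminus A}))\vert\geq\vert\mathcal{F}(A,\overline{X\setminus A})\vert$ for all $X\subseteq[n]$.) -}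

module Defs where

open import Data.Bool using (Bool; true; false; _∧_; if_then_else_)
open import Data.Bool.Properties using () renaming (_≟_ to _≟ᵇ_)
open import Data.Nat using (ℕ; zero; suc; _+_; _≤_)
open import Data.Fin using (Fin)
open import Data.Fin.Subset using (Subset; ⊥; _∩_; _─_; _-_; _⊆_; _∈_; ∣_∣; Nonempty)
open import Data.Fin.Subset.Properties using (_⊆?_; _∈?_)
open import Data.List using (List; []; _∷_; map; _++_; filterᵇ; length; allFin)
open import Data.Bool.ListAction using (any)
open import Data.Vec using (Vec; []; _∷_)
open import Data.Vec.Properties using (≡-dec)
open import Relation.Nullary.Decidable using (⌊_⌋)
open import Relation.Binary.PropositionalEquality using (_≡_)

allSubsets : (n : ℕ) → List (Subset n)
allSubsets zero = [] ∷ []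
allSubsets (suc n) = map (false ∷_) (allSubsets n) ++ map (true ∷_) (allSubsets n)

Fam : ℕ → Set
Fam n = Subset n → Bool

_∈ᶠ_ : {n : ℕ} → Subset n → Fam n → Set
S ∈ᶠ H = H S ≡ true

card : {n : ℕ} → Fam n → ℕ
card {n} H = length (filterᵇ H (allSubsets n))

_==_ : {n : ℕ} → Subset n → Subset n → Bool
S == T = ⌊ ≡-dec _≟ᵇ_ S T ⌋

shadow : {n : ℕ} → Fam n → Fam n
shadow {n} H S =
  any (λ T → H T ∧ any (λ x → ⌊ x ∈? T ⌋ ∧ ((T - x) == S)) (allFin n)) (allSubsets n)

link : {n : ℕ} → Fam n → Subset n → Subset n → Fam n
link {n} F A B S =
  any (λ T → F T ∧ ⌊ A ⊆? T ⌋ ∧ ((B ∩ T) == ⊥) ∧ ((T ─ A) == S)) (allSubsets n)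

linkOf : {n : ℕ} → Fam n → Subset n → Fam n
linkOf F A = link F A ⊥

avoid : {n : ℕ} → Fam n → Subset n → Fam n
avoid H X S = H S ∧ ((S ∩ X) == ⊥)

PseudoIntersecting : {n : ℕ} → Fam n → Set
PseudoIntersecting {n} H = (X : Subset n) → card (avoid H X) ≤ card (shadow (avoid H X))

Uniform : {n : ℕ} → ℕ → Fam n → Set
Uniform k F = ∀ S → S ∈ᶠ F → ∣ S ∣ ≡ k

Intersecting : {n : ℕ} → Fam n → Set
Intersecting F = ∀ S T → S ∈ᶠ F → T ∈ᶠ F → Nonempty (S ∩ T)

sumFromTo : ℕ → ℕ → ℕ
sumFromTo i k = if i Data.Nat.≤ᵇ k then go (k Data.Nat.∸ i) else 0
  where
  go : ℕ → ℕ
  go zero = i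
  go (suc t) = (i + suc t) + go t

module Submission where

-- Start with M = [n]. For i = k, …, 1 look for a "bad" A ⊆ M of size i, that is, one with
-- |∂(F(A, X̄))| < |F(A, X̄)| for some X, and if there is one delete it from M. Suppose a second bad B
-- survived. As all (i+1)-subsets of the old M are good, splitting off the sets containing a given
-- b ∈ B shows that A stays bad when X is enlarged by B; likewise for B and A. The two resulting
-- families are uniform of the same rank and cross-intersecting, since F is intersecting.
--
-- But if H and G are m-uniform and cross-intersecting, then |H| ≤ |∂H| or |G| ≤ |∂G|. Shifting H and
-- G simultaneously reduces this to shifted families. If no set of H contains at most half of every
-- initial segment, |H| ≤ |∂H| follows by induction on n, from local LYM when n < 2m. If H and G both contain
-- such sets, shifting one of them yields a disjoint pair.

open import Defs
open import Algebra.Bundles using (CommutativeMonoid)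
open import Data.Bool using (Bool; true; false; _∧_; _∨_; if_then_else_)
open import Data.Bool.ListAction using (any)
import Data.Bool.Properties as Bool
open import Data.Bool.Properties using (∧-conicalˡ; ∧-conicalʳ; T-≡)
open import Data.Empty using () renaming (⊥ to False)
open import Data.Fin using (Fin; zero; suc)
open import Data.Fin.Properties using (any?)
open import Data.Fin.Subset
open import Data.Fin.Subset.Properties
open import Data.List using (List; []; _∷_; map; filterᵇ; length; allFin; _++_)
open import Data.List.Membership.Propositional using () renaming (_∈_ to _∈ₗ_; lose to loseₗ)
open import Data.List.Membership.Propositional.Properties using (∈-++⁺ˡ; ∈-++⁺ʳ; ∈-map⁺; ∈-allFin)
open import Data.List.Properties using (filter-++; length-++)
open import Data.List.Relation.Unary.Any using (here; there; satisfied)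
open import Data.List.Relation.Unary.Any.Properties using (any⁺; any⁻)
open import Data.Nat
open import Data.Nat.Induction using (<-wellFounded)
open import Data.Nat.Properties
open import Data.Nat.Tactic.RingSolver using (solve-∀)
open import Data.Product using (Σ; _×_; _,_; proj₁; proj₂; ∃; map₂)
open import Data.Sum using (_⊎_; inj₁; inj₂; [_,_]′)
open import Data.Unit using (tt) renaming (⊤ to Unit)
open import Data.Vec using ([]; _∷_; here; there)
open import Data.Vec.Properties using (∷-injective)
open import Function using (_∘_; id)
open import Function.Bundles using (Equivalence)
open import Induction.WellFounded using (Acc; acc)
open import Relation.Binary.PropositionalEquality
open import Relation.Nullary using (¬_; yes; no; Dec; contradiction; _×-dec_)
open import Relation.Nullary.Decidable using (⌊_⌋; T?)
open import Algebra.Properties.CommutativeSemigroup +-commutativeSemigroup using (x∙yz≈y∙xz)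
  renaming (interchange to +-interchange)
open import Algebra.Properties.CommutativeSemigroup
  (CommutativeMonoid.commutativeSemigroup Bool.∨-commutativeMonoid)
  using () renaming (interchange to ∨-interchange)

private variable
  n m : ℕ
  A : Set

-- Splitting off the lowest term of the sum from `i` to `k`

-- The summation loop of sumFromTo is local to Defs. Abstracting k ∸ i turns the equation below
-- into one whose unique solution for the body of ascending is that loop.
mutual
  ascending : ℕ → ℕ → ℕ → ℕ
  ascending i k d = _

  sumFromTo-ascending : ∀ i k → (if i ≤ᵇ k then ascending i k (k ∸ i) else 0) ≡ sumFromTo i k
  sumFromTo-ascending i k with k ∸ i
  ... | d = refl

-- The loop adds terms from the top, whereas the induction on levels adds a new lowest term; this
-- converts one order into the other.
ascending-suc : ∀ i k d → ascending i k (suc d) ≡ i + ascending (suc i) k d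
ascending-suc i k zero    = trans (+-comm (i + 1) i) (cong (i +_) (+-comm i 1))
ascending-suc i k (suc d) = begin
  (i + suc (suc d)) + ascending i k (suc d)          ≡⟨ cong₂ _+_ (+-suc i (suc d)) (ascending-suc i k d) ⟩
  (suc i + suc d) + (i + ascending (suc i) k d)      ≡⟨ x∙yz≈y∙xz (suc i + suc d) i _ ⟩
  i + ((suc i + suc d) + ascending (suc i) k d)      ∎
  where open ≡-Reasoning

sumFromTo-of-≤ : ∀ {i k} → i ≤ k → sumFromTo i k ≡ ascending i k (k ∸ i)
sumFromTo-of-≤ {i} {k} i≤k = trans (sym (sumFromTo-ascending i k))
  (cong (if_then ascending i k (k ∸ i) else 0) (Equivalence.to T-≡ (≤⇒≤ᵇ i≤k)))

sumFromTo-step : ∀ {i k} → i ≤ k → sumFromTo i k ≡ i + sumFromTo (suc i) k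
sumFromTo-step {i} {k} i≤k with m≤n⇒m<n∨m≡n i≤k
... | inj₁ i<k = begin
  sumFromTo i k                               ≡⟨ sumFromTo-of-≤ i≤k ⟩
  ascending i k (k ∸ i)                       ≡⟨ cong (ascending i k) (+-∸-assoc 1 i<k) ⟩
  ascending i k (suc (k ∸ suc i))             ≡⟨ ascending-suc i k (k ∸ suc i) ⟩
  i + ascending (suc i) k (k ∸ suc i)         ≡⟨ cong (i +_) (sumFromTo-of-≤ i<k) ⟨
  i + sumFromTo (suc i) k                     ∎
  where open ≡-Reasoning
... | inj₂ refl = begin
  sumFromTo i i                    ≡⟨ sumFromTo-of-≤ i≤k ⟩
  ascending i i (i ∸ i)            ≡⟨ cong (ascending i i) (n∸n≡0 i) ⟩
  i                                ≡⟨ +-identityʳ i ⟨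
  i + 0                            ≡⟨ cong (i +_) empty ⟨
  i + sumFromTo (suc i) i          ∎
  where
  open ≡-Reasoning
  -- The range from `suc i` to `i` is empty, so the guard of `sumFromTo` yields its default 0.
  empty : sumFromTo (suc i) i ≡ 0
  empty with suc i ≤ᵇ i in eq
  ... | true  = contradiction (≤ᵇ⇒≤ (suc i) i (Equivalence.from T-≡ eq)) 1+n≰n
  ... | false = refl

-- Boolean families, their slices and their counts

∨-true⁻ : ∀ a {b} → a ∨ b ≡ true → a ≡ true ⊎ b ≡ true
∨-true⁻ true  _ = inj₁ refl
∨-true⁻ false b = inj₂ b

∨-true⁺ : ∀ a {b} → a ≡ true ⊎ b ≡ true → a ∨ b ≡ true
∨-true⁺ true  _        = refl
∨-true⁺ false (inj₂ b) = b

infixl 9 _⟨_⟩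
infixr 7 _∩ᶠ_
infixr 6 _∪ᶠ_
infix 4 _⊑_

_⟨_⟩ : Fam (suc n) → Bool → Fam n
(H ⟨ b ⟩) S = H (b ∷ S)

_∩ᶠ_ _∪ᶠ_ : Fam n → Fam n → Fam n
(H ∩ᶠ G) S = H S ∧ G S
(H ∪ᶠ G) S = H S ∨ G S

_⊑_ : Fam n → Fam n → Set
H ⊑ G = ∀ S → S ∈ᶠ H → S ∈ᶠ G

∪ᶠ-mono : {H H′ G G′ : Fam n} → H ⊑ H′ → G ⊑ G′ → H ∪ᶠ G ⊑ H′ ∪ᶠ G′
∪ᶠ-mono {H = H} {H′} p q S = ∨-true⁺ (H′ S) ∘ [ inj₁ ∘ p S , inj₂ ∘ q S ]′ ∘ ∨-true⁻ (H S)

count : Fam n → ℕ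
count {zero}  H = if H [] then 1 else 0
count {suc n} H = count (H ⟨ false ⟩) + count (H ⟨ true ⟩)

count-mono : {H G : Fam n} → H ⊑ G → count H ≤ count G
count-mono {zero} {H} {G} p with H [] in eq
... | false = z≤n
... | true rewrite p [] eq = ≤-refl
count-mono {suc n} p = +-mono-≤ (count-mono (p ∘ (false ∷_))) (count-mono (p ∘ (true ∷_)))

count-empty : {H : Fam n} → (∀ S → ¬ S ∈ᶠ H) → count H ≡ 0
count-empty {zero} {H} p with H [] in eq
... | false = refl
... | true  = contradiction eq (p [])
count-empty {suc n} p = cong₂ _+_ (count-empty (p ∘ (false ∷_))) (count-empty (p ∘ (true ∷_)))

-- A shift replaces two slices by their intersection and their union, so this is why it preserves
-- the number of sets.
count-∩-∪ : (H G : Fam n) → count (H ∩ᶠ G) + count (H ∪ᶠ G) ≡ count H + count G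
count-∩-∪ {zero} H G with H [] | G []
... | false | false = refl
... | false | true  = refl
... | true  | false = refl
... | true  | true  = refl
count-∩-∪ {suc n} H G = trans (+-interchange (count (H₀ ∩ᶠ G₀)) _ _ _)
  (trans (cong₂ _+_ (count-∩-∪ H₀ G₀) (count-∩-∪ H₁ G₁)) (+-interchange (count H₀) _ _ _))
  where
  H₀ = H ⟨ false ⟩
  H₁ = H ⟨ true ⟩
  G₀ = G ⟨ false ⟩
  G₁ = G ⟨ true ⟩

-- Transfers tightness of a sum of two inequalities to each summand: to the two slices of a family,
-- or to two families shifted together.
+-tight : ∀ {a b c d} → a ≤ b → c ≤ d → b + d ≤ a + c → b ≤ a × d ≤ c
+-tight {a} {b} {c} {d} a≤b c≤d le =
  +-cancelʳ-≤ d b a (≤-trans le (+-monoʳ-≤ a c≤d)) , +-cancelˡ-≤ b d c (≤-trans le (+-monoˡ-≤ c a≤b))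

⊑-of-count : {H G : Fam n} → H ⊑ G → count G ≤ count H → G ⊑ H
⊑-of-count {zero} {H} {G} p c [] q rewrite q with H []
... | true = refl
⊑-of-count {suc n} p c (b ∷ S) with +-tight (count-mono (p ∘ (false ∷_))) (count-mono (p ∘ (true ∷_))) c | b
... | c₀ , _ | false = ⊑-of-count (p ∘ (false ∷_)) c₀ S
... | _ , c₁ | true  = ⊑-of-count (p ∘ (true ∷_)) c₁ S

-- Shadows and the local LYM inequality

-- A recursive form of `shadow`: the element removed lies either in the tail or, if the head is
-- absent afterwards, possibly at the head.
∂ : Fam n → Fam n
∂ {zero}  H S           = false
∂ {suc n} H (false ∷ S) = ∂ (H ⟨ false ⟩) S ∨ H (true ∷ S)
∂ {suc n} H (true ∷ S)  = ∂ (H ⟨ true ⟩) S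

∂-mono : {H G : Fam n} → H ⊑ G → ∂ H ⊑ ∂ G
∂-mono {suc n} {H} {G} p (false ∷ S) =
  ∪ᶠ-mono {H = ∂ (H ⟨ false ⟩)} {∂ (G ⟨ false ⟩)} (∂-mono (p ∘ (false ∷_))) (p ∘ (true ∷_)) S
∂-mono {suc n} p (true ∷ S) = ∂-mono (p ∘ (true ∷_)) S

∂-∪ : (H G : Fam n) (S : Subset n) → ∂ (H ∪ᶠ G) S ≡ ∂ H S ∨ ∂ G S
∂-∪ {zero}  H G S           = refl
∂-∪ {suc n} H G (true ∷ S)  = ∂-∪ (H ⟨ true ⟩) (G ⟨ true ⟩) S
∂-∪ {suc n} H G (false ∷ S) = trans (cong (_∨ (H (true ∷ S) ∨ G (true ∷ S))) (∂-∪ (H ⟨ false ⟩) (G ⟨ false ⟩) S))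
  (∨-interchange (∂ (H ⟨ false ⟩) S) _ _ _)

-- Here `r` is n - m + 1. Instead of double counting, the induction uses that the slice
-- `∂ H ⟨ false ⟩` contains both `∂ (H ⟨ false ⟩)`, charged r - 1 times, and `H ⟨ true ⟩`, charged
-- once.
local-LYM : ∀ {n m} r {H : Fam n} → Uniform m H → suc n ≡ m + r → m * count H ≤ r * count (∂ H)
local-LYM {n} {zero} r u e = z≤n
local-LYM {n} {suc m} zero {H} u e = ≤-reflexive (trans (cong (suc m *_) (count-empty {H = H} empty)) (*-zeroʳ m))
  where
  empty : ∀ S → ¬ S ∈ᶠ H
  empty S S∈H = <⇒≱ (≤-reflexive (sym (cong suc (trans (sym (+-identityʳ m)) (suc-injective (sym e))))))
    (≤-trans (≤-reflexive (sym (u S S∈H))) (∣p∣≤n S))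
local-LYM {zero} {suc zero} (suc r) u ()
local-LYM {zero} {suc (suc m)} (suc r) u ()
local-LYM {suc n} {suc m} (suc r) {H} u e = begin
  suc m * (c₀ + c₁)              ≡⟨ *-distribˡ-+ (suc m) c₀ c₁ ⟩
  suc m * c₀ + (c₁ + m * c₁)     ≤⟨ +-mono-≤ ih₀ (+-monoʳ-≤ c₁ ih₁) ⟩
  r * d₀ + (c₁ + suc r * d₁)     ≤⟨ +-mono-≤ (*-monoʳ-≤ r d₀≤d) (+-monoˡ-≤ (suc r * d₁) c₁≤d) ⟩
  r * d + (d + suc r * d₁)       ≡⟨ +-assoc (r * d) d (suc r * d₁) ⟨
  (r * d + d) + suc r * d₁       ≡⟨ cong (_+ suc r * d₁) (+-comm (r * d) d) ⟩
  suc r * d + suc r * d₁         ≡⟨ *-distribˡ-+ (suc r) d d₁ ⟨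
  suc r * (d + d₁)               ∎
  where
  open ≤-Reasoning
  c₀ = count (H ⟨ false ⟩)
  c₁ = count (H ⟨ true ⟩)
  d₀ = count (∂ (H ⟨ false ⟩))
  d₁ = count (∂ (H ⟨ true ⟩))
  d  = count (∂ H ⟨ false ⟩)
  d₀≤d : d₀ ≤ d
  d₀≤d = count-mono λ S → ∨-true⁺ (∂ (H ⟨ false ⟩) S) ∘ inj₁
  c₁≤d : c₁ ≤ d
  c₁≤d = count-mono λ S → ∨-true⁺ (∂ (H ⟨ false ⟩) S) ∘ inj₂
  ih₀ : suc m * c₀ ≤ r * d₀
  ih₀ = local-LYM r (u ∘ (false ∷_)) (trans (suc-injective e) (+-suc m r))
  ih₁ : m * c₁ ≤ suc r * d₁
  ih₁ = local-LYM (suc r) (λ S → suc-injective ∘ u (true ∷ S)) (suc-injective e)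

-- When n < 2m, the factor n + 1 - m of local LYM is at most m and cancels. Ranks above n leave `H`
-- empty.
shadow-large : ∀ {n m} {H : Fam n} → Uniform m H → n < m + m → count H ≤ count (∂ H)
shadow-large {n} {m} {H} u n<2m with m ≤? n
... | no m≰n = ≤-trans (≤-reflexive (count-empty {H = H} λ S S∈H →
        m≰n (≤-trans (≤-reflexive (sym (u S S∈H))) (∣p∣≤n S)))) z≤n
shadow-large {n} {zero}  u () | yes _
shadow-large {n} {m@(suc _)} {H} u n<2m | yes m≤n = *-cancelˡ-≤ m (≤-trans
  (local-LYM (suc n ∸ m) u (sym (m+[n∸m]≡n (m≤n⇒m≤1+n m≤n))))
  (*-monoˡ-≤ (count (∂ H)) (≤-trans (∸-monoˡ-≤ m n<2m) (≤-reflexive (m+n∸n≡m m m)))))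

-- Families without ballot sets

-- The head of a vector stands for the largest element of the ground set, so suffixes of vectors are
-- initial segments.
CrossBallot : Subset n → Subset n → Set
CrossBallot []      []      = Unit
CrossBallot {suc n} (a ∷ S) (b ∷ T) = ∣ a ∷ S ∣ + ∣ b ∷ T ∣ ≤ suc n × CrossBallot S T

crossBallot? : (S T : Subset n) → Dec (CrossBallot S T)
crossBallot? []      []      = yes tt
crossBallot? (a ∷ S) (b ∷ T) = (_ ≤? _) ×-dec crossBallot? S T

-- If 2m is at most the size of the ground set, the ballot condition on the whole vector is
-- automatic, so a ballot set in a slice would extend to one in `H`. Hence both slices are free of
-- ballot sets and induction applies; otherwise `shadow-large` does.
shadow-noBallot : ∀ {n m} {H : Fam n} → Uniform m H → (∀ S → S ∈ᶠ H → ¬ CrossBallot S S) → count H ≤ count (∂ H)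
shadow-noBallot {zero} {m} {H} u nb = ≤-reflexive (count-empty {H = H} λ { [] S∈H → nb [] S∈H tt })
shadow-noBallot {suc n} {m} {H} u nb with m + m ≤? suc n
... | no  2m≰n = shadow-large u (≰⇒> 2m≰n)
... | yes 2m≤n = ≤-trans (+-mono-≤ ih₀ (ih₁ m u 2m≤n)) (+-monoˡ-≤ _ (count-mono λ S → ∨-true⁺ (∂ (H ⟨ false ⟩) S) ∘ inj₁))
  where
  fits : ∀ {k} b {S : Subset n} → (b ∷ S) ∈ᶠ H → Uniform k H → k + k ≤ suc n → CrossBallot S S → CrossBallot (b ∷ S) (b ∷ S)
  fits b S∈H u le bal = ≤-trans (≤-reflexive (cong₂ _+_ (u _ S∈H) (u _ S∈H))) le , bal
  ih₀ = shadow-noBallot (u ∘ (false ∷_)) λ S S∈H → nb (false ∷ S) S∈H ∘ fits false S∈H u 2m≤n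
  ih₁ : ∀ k → Uniform k H → k + k ≤ suc n → count (H ⟨ true ⟩) ≤ count (∂ (H ⟨ true ⟩))
  -- At rank 0 no member contains the head, so this slice is empty.
  ih₁ zero u le = ≤-trans (≤-reflexive (count-empty {H = H ⟨ true ⟩} λ S S∈H → 1+n≢0 (u (true ∷ S) S∈H))) z≤n
  ih₁ (suc k) u le = shadow-noBallot (λ S → suc-injective ∘ u (true ∷ S))
    λ S S∈H → nb (true ∷ S) S∈H ∘ fits true S∈H u le

-- Adjacent shifts

-- Replaces the largest element by the second largest one, in every set that has the former but not
-- the latter and whose image is not yet present.
headShift : Fam (suc n) → Fam (suc n)
headShift {zero}  H S                   = H S
headShift {suc n} H (true ∷ true ∷ S)   = H (true ∷ true ∷ S)
headShift {suc n} H (true ∷ false ∷ S)  = H (true ∷ false ∷ S) ∧ H (false ∷ true ∷ S)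
headShift {suc n} H (false ∷ true ∷ S)  = H (true ∷ false ∷ S) ∨ H (false ∷ true ∷ S)
headShift {suc n} H (false ∷ false ∷ S) = H (false ∷ false ∷ S)

-- Index `i` exchanges positions `i` and `i + 1` after every prefix of length `i`; the last index
-- acts as the identity.
shift : Fin n → Fam n → Fam n
shift zero    H         = headShift H
shift (suc i) H (b ∷ S) = shift i (H ⟨ b ⟩) S

shift-mono : (i : Fin n) {H G : Fam n} → H ⊑ G → shift i H ⊑ shift i G
shift-mono {suc zero}    zero    p = p
shift-mono {suc (suc n)} zero    p (true ∷ true ∷ S) = p _
shift-mono {suc (suc n)} zero {H} {G} p (true ∷ false ∷ S) e =
  cong₂ _∧_ (p _ (∧-conicalˡ _ _ e)) (p _ (∧-conicalʳ (H (true ∷ false ∷ S)) _ e))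
shift-mono {suc (suc n)} zero {H} {G} p (false ∷ true ∷ S) =
  ∪ᶠ-mono {H = H ⟨ true ⟩ ⟨ false ⟩} {G ⟨ true ⟩ ⟨ false ⟩} (λ S → p _) (λ S → p (false ∷ true ∷ S)) S
shift-mono {suc (suc n)} zero    p (false ∷ false ∷ S) = p _
shift-mono {suc n}       (suc i) {H} {G} p (b ∷ S) = shift-mono i {H ⟨ b ⟩} {G ⟨ b ⟩} (p ∘ (b ∷_)) S

count-shift : (i : Fin n) (H : Fam n) → count (shift i H) ≡ count H
count-shift {suc zero}    zero    H = refl
count-shift {suc (suc n)} zero    H = begin
  (c₀₀ + count (H₁₀ ∪ᶠ H₀₁)) + (count (H₁₀ ∩ᶠ H₀₁) + c₁₁)  ≡⟨ regroup c₀₀ _ (count (H₁₀ ∩ᶠ H₀₁)) _ ⟩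
  c₀₀ + (count (H₁₀ ∩ᶠ H₀₁) + count (H₁₀ ∪ᶠ H₀₁)) + c₁₁    ≡⟨ cong (λ t → c₀₀ + t + c₁₁) (count-∩-∪ H₁₀ H₀₁) ⟩
  c₀₀ + (count H₁₀ + count H₀₁) + c₁₁                      ≡⟨ regroup c₀₀ _ (count H₁₀) _ ⟨
  (c₀₀ + count H₀₁) + (count H₁₀ + c₁₁)                    ∎
  where
  open ≡-Reasoning
  H₁₀ = H ⟨ true ⟩ ⟨ false ⟩
  H₀₁ = H ⟨ false ⟩ ⟨ true ⟩
  c₀₀ = count (H ⟨ false ⟩ ⟨ false ⟩)
  c₁₁ = count (H ⟨ true ⟩ ⟨ true ⟩)
  regroup : ∀ a b c d → (a + b) + (c + d) ≡ a + (c + b) + d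
  regroup = solve-∀
count-shift {suc n} (suc i) H = cong₂ _+_ (count-shift i (H ⟨ false ⟩)) (count-shift i (H ⟨ true ⟩))

shift-size : (i : Fin n) (H : Fam n) (S : Subset n) → S ∈ᶠ shift i H → ∃ λ T → T ∈ᶠ H × ∣ T ∣ ≡ ∣ S ∣
shift-size {suc zero}    zero    H S e = S , e , refl
shift-size {suc (suc n)} zero    H (true ∷ true ∷ S)   e = _ , e , refl
shift-size {suc (suc n)} zero    H (true ∷ false ∷ S)  e = _ , ∧-conicalˡ _ _ e , refl
shift-size {suc (suc n)} zero    H (false ∷ true ∷ S)  e with ∨-true⁻ (H (true ∷ false ∷ S)) e
... | inj₁ p = true ∷ false ∷ S , p , refl
... | inj₂ p = false ∷ true ∷ S , p , refl
shift-size {suc (suc n)} zero    H (false ∷ false ∷ S) e = _ , e , refl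
shift-size {suc n} (suc i) H (false ∷ S) e with shift-size i (H ⟨ false ⟩) S e
... | T , T∈H , size = false ∷ T , T∈H , size
shift-size {suc n} (suc i) H (true ∷ S) e with shift-size i (H ⟨ true ⟩) S e
... | T , T∈H , size = true ∷ T , T∈H , cong suc size

uniform-shift : (i : Fin n) {H : Fam n} → Uniform m H → Uniform m (shift i H)
uniform-shift i {H} u S e with shift-size i H S e
... | T , T∈H , size = trans (sym size) (u T T∈H)

-- For a head shift, the slice with the head only works because the shadow of an intersection lies
-- in both shadows, and the slice with the second position only because `∂` commutes with unions.
∂-shift : (i : Fin n) (H : Fam n) → ∂ (shift i H) ⊑ shift i (∂ H)
∂-shift {suc zero}    zero    H S = id
∂-shift {suc (suc n)} zero    H (true ∷ true ∷ S) = id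
∂-shift {suc (suc n)} zero    H (true ∷ false ∷ S) e =
  [ (λ p → cong₂ _∧_ (∨-true⁺ _ (inj₁ (∂-mono (λ T → ∧-conicalˡ _ _) S p)))
                     (∨-true⁺ _ (inj₁ (∂-mono (λ T → ∧-conicalʳ (H (true ∷ false ∷ T)) _) S p))))
  , (λ p → cong₂ _∧_ (∨-true⁺ (∂ (H ⟨ true ⟩ ⟨ false ⟩) S) (inj₂ p)) (∨-true⁺ (∂ (H ⟨ false ⟩ ⟨ true ⟩) S) (inj₂ p)))
  ]′ (∨-true⁻ (∂ (H ⟨ true ⟩ ⟨ false ⟩ ∩ᶠ H ⟨ false ⟩ ⟨ true ⟩) S) e)
∂-shift {suc (suc n)} zero    H (false ∷ true ∷ S) e
  rewrite ∂-∪ (H ⟨ true ⟩ ⟨ false ⟩) (H ⟨ false ⟩ ⟨ true ⟩) S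
  with ∂ (H ⟨ true ⟩ ⟨ false ⟩) S | ∂ (H ⟨ false ⟩ ⟨ true ⟩) S | H (true ∷ true ∷ S)
... | true  | _     | _    = refl
... | false | true  | x    = Bool.∨-zeroʳ x
... | false | false | true = refl
∂-shift {suc (suc n)} zero    H (false ∷ false ∷ S) e
  with ∂ (H ⟨ false ⟩ ⟨ false ⟩) S | H (true ∷ false ∷ S) | H (false ∷ true ∷ S)
... | true  | _     | _     = refl
... | false | true  | true  = refl
... | false | true  | false = refl
... | false | false | true  = refl
∂-shift {suc n} (suc i) H (true ∷ S) = ∂-shift i (H ⟨ true ⟩) S
∂-shift {suc n} (suc i) H (false ∷ S) e with ∨-true⁻ (∂ (shift i (H ⟨ false ⟩)) S) e
... | inj₁ p = shift-mono i {∂ (H ⟨ false ⟩)} {∂ H ⟨ false ⟩} (λ T → ∨-true⁺ _ ∘ inj₁) S (∂-shift i (H ⟨ false ⟩) S p)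
... | inj₂ p = shift-mono i {H ⟨ true ⟩} {∂ H ⟨ false ⟩} (λ T → ∨-true⁺ (∂ (H ⟨ false ⟩) T) ∘ inj₂) S p

count-∂-shift : (i : Fin n) (H : Fam n) → count (∂ (shift i H)) ≤ count (∂ H)
count-∂-shift i H = ≤-trans (count-mono (∂-shift i H)) (≤-reflexive (count-shift i (∂ H)))

-- Disjointness is an equation between vectors so that it splits coordinate by coordinate.
Cross : Fam n → Fam n → Set
Cross H G = ∀ {S T} → S ∩ T ≡ ⊥ → S ∈ᶠ H → T ∈ᶠ G → False

cross-slice : ∀ {a b} {H G : Fam (suc n)} → a ∧ b ≡ false → Cross H G → Cross (H ⟨ a ⟩) (G ⟨ b ⟩)
cross-slice ab cr dis = cr (cong₂ _∷_ ab dis)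

-- In the critical case the two sets differ at both shifted positions. The one with the higher
-- position has both its versions in the original family, so one of them is disjoint from whichever
-- version of the other set was present.
cross-shift : (i : Fin n) {H G : Fam n} → Cross H G → Cross (shift i H) (shift i G)
cross-shift {suc zero} zero cr = cr
cross-shift {suc (suc n)} zero {H} {G} cr {a ∷ b ∷ S} {c ∷ d ∷ T} dis with ∷-injective dis
... | ac , dis′ with ∷-injective dis′
... | bd , ST = go a b c d ac bd
  where
  go : ∀ a b c d → a ∧ c ≡ false → b ∧ d ≡ false →
    (a ∷ b ∷ S) ∈ᶠ shift zero H → (c ∷ d ∷ T) ∈ᶠ shift zero G → False
  disjoint : ∀ {a b c d} → a ∧ c ≡ false → b ∧ d ≡ false →
    (a ∷ b ∷ S) ∈ᶠ H → (c ∷ d ∷ T) ∈ᶠ G → False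
  disjoint ac bd = cr (cong₂ _∷_ ac (cong₂ _∷_ bd ST))
  go true  true  false false ac bd p q = disjoint ac bd p q
  go false false true  true  ac bd p q = disjoint ac bd p q
  go false false false false ac bd p q = disjoint ac bd p q
  go true  false false false ac bd p q = disjoint ac bd (∧-conicalˡ _ _ p) q
  go false false true  false ac bd p q = disjoint ac bd p (∧-conicalˡ _ _ q)
  go false true  false false ac bd p q =
    [ (λ p → disjoint refl refl p q) , (λ p → disjoint refl refl p q) ]′ (∨-true⁻ (H (true ∷ false ∷ S)) p)
  go false false false true  ac bd p q =
    [ disjoint refl refl p , disjoint refl refl p ]′ (∨-true⁻ (G (true ∷ false ∷ T)) q)
  go true  false false true  ac bd p q =
    [ disjoint refl refl (∧-conicalʳ (H (true ∷ false ∷ S)) _ p) , disjoint refl refl (∧-conicalˡ _ _ p) ]′ (∨-true⁻ (G (true ∷ false ∷ T)) q)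
  go false true  true  false ac bd p q =
    [ (λ p → disjoint refl refl p (∧-conicalʳ (G (true ∷ false ∷ T)) _ q)) , (λ p → disjoint refl refl p (∧-conicalˡ _ _ q)) ]′
      (∨-true⁻ (H (true ∷ false ∷ S)) p)
  go false true  false true  ac ()
cross-shift {suc n} (suc i) {H} {G} cr {a ∷ S} {c ∷ T} dis with ∷-injective dis
... | ac , ST = cross-shift i {H ⟨ a ⟩} {G ⟨ c ⟩} (cross-slice {H = H} {G} ac cr) ST

-- Element sums and stable families

-- The sum over all sets in H of their elements, the ground set being {0, …, n-1}.
potential : Fam n → ℕ
potential {zero}  H = 0
potential {suc n} H = potential (H ⟨ false ⟩) + potential (H ⟨ true ⟩) + n * count (H ⟨ true ⟩)

potential-∩-∪ : (H G : Fam n) → potential (H ∩ᶠ G) + potential (H ∪ᶠ G) ≡ potential H + potential G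
potential-∩-∪ {zero}  H G = refl
potential-∩-∪ {suc n} H G = begin
  (potential (H₀ ∩ᶠ G₀) + potential (H₁ ∩ᶠ G₁) + n * count (H₁ ∩ᶠ G₁)) + (potential (H₀ ∪ᶠ G₀) + potential (H₁ ∪ᶠ G₁) + n * count (H₁ ∪ᶠ G₁))
    ≡⟨ regroup n (potential (H₀ ∩ᶠ G₀)) _ _ (potential (H₀ ∪ᶠ G₀)) _ _ ⟩
  (potential (H₀ ∩ᶠ G₀) + potential (H₀ ∪ᶠ G₀)) + (potential (H₁ ∩ᶠ G₁) + potential (H₁ ∪ᶠ G₁)) + n * (count (H₁ ∩ᶠ G₁) + count (H₁ ∪ᶠ G₁))
    ≡⟨ cong₂ (λ x y → x + n * y) (cong₂ _+_ (potential-∩-∪ H₀ G₀) (potential-∩-∪ H₁ G₁)) (count-∩-∪ H₁ G₁) ⟩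
  (potential H₀ + potential G₀) + (potential H₁ + potential G₁) + n * (count H₁ + count G₁)
    ≡⟨ regroup n (potential H₀) _ _ (potential G₀) _ _ ⟨
  potential H + potential G ∎
  where
  open ≡-Reasoning
  H₀ = H ⟨ false ⟩
  H₁ = H ⟨ true ⟩
  G₀ = G ⟨ false ⟩
  G₁ = G ⟨ true ⟩
  regroup : ∀ n a b c d e f → (a + b + n * c) + (d + e + n * f) ≡ (a + d) + (b + e) + n * (c + f)
  regroup = solve-∀

-- A head shift lowers by one the element sum of each S with S in H₁₀ but not in H₀₁; the equation is
-- stated without subtraction.
potential-shift-head : (H : Fam (suc (suc n))) →
  potential (shift zero H) + count (H ⟨ true ⟩ ⟨ false ⟩) ≡ potential H + count (H ⟨ true ⟩ ⟨ false ⟩ ∩ᶠ H ⟨ false ⟩ ⟨ true ⟩)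
potential-shift-head {n} H = begin
  (p₀₀ + potential (H₁₀ ∪ᶠ H₀₁) + n * count (H₁₀ ∪ᶠ H₀₁))
    + (potential (H₁₀ ∩ᶠ H₀₁) + p₁₁ + n * c₁₁) + suc n * (count (H₁₀ ∩ᶠ H₀₁) + c₁₁) + count H₁₀
    ≡⟨ before n p₀₀ (potential (H₁₀ ∪ᶠ H₀₁)) (count (H₁₀ ∪ᶠ H₀₁)) (potential (H₁₀ ∩ᶠ H₀₁)) p₁₁ c₁₁ (count (H₁₀ ∩ᶠ H₀₁)) (count H₁₀) ⟩
  (p₀₀ + p₁₁ + (n + suc n) * c₁₁ + count (H₁₀ ∩ᶠ H₀₁) + count H₁₀) + (potential (H₁₀ ∩ᶠ H₀₁) + potential (H₁₀ ∪ᶠ H₀₁)) + n * (count (H₁₀ ∩ᶠ H₀₁) + count (H₁₀ ∪ᶠ H₀₁))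
    ≡⟨ cong₂ (λ x y → p₀₀ + p₁₁ + (n + suc n) * c₁₁ + count (H₁₀ ∩ᶠ H₀₁) + count H₁₀ + x + n * y) (potential-∩-∪ H₁₀ H₀₁) (count-∩-∪ H₁₀ H₀₁) ⟩
  (p₀₀ + p₁₁ + (n + suc n) * c₁₁ + count (H₁₀ ∩ᶠ H₀₁) + count H₁₀) + (potential H₁₀ + potential H₀₁) + n * (count H₁₀ + count H₀₁)
    ≡⟨ after n p₀₀ (potential H₀₁) (count H₀₁) (potential H₁₀) p₁₁ c₁₁ (count H₁₀) (count (H₁₀ ∩ᶠ H₀₁)) ⟨
  potential H + count (H₁₀ ∩ᶠ H₀₁) ∎
  where
  open ≡-Reasoning
  H₁₀ = H ⟨ true ⟩ ⟨ false ⟩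
  H₀₁ = H ⟨ false ⟩ ⟨ true ⟩
  p₀₀ = potential (H ⟨ false ⟩ ⟨ false ⟩)
  p₁₁ = potential (H ⟨ true ⟩ ⟨ true ⟩)
  c₁₁ = count (H ⟨ true ⟩ ⟨ true ⟩)
  before : ∀ n p q c r s d e f →
    (p + q + n * c) + (r + s + n * d) + suc n * (e + d) + f
    ≡ (p + s + (n + suc n) * d + e + f) + (r + q) + n * (e + c)
  before = solve-∀
  after : ∀ n p q c r s d e f →
    (p + q + n * c) + (r + s + n * d) + suc n * (e + d) + f
    ≡ (p + s + (n + suc n) * d + f + e) + (r + q) + n * (e + c)
  after = solve-∀

potential-shift-≤ : (i : Fin n) (H : Fam n) → potential (shift i H) ≤ potential H
potential-shift-≤ {suc zero}    zero H = ≤-refl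
potential-shift-≤ {suc (suc n)} zero H = +-cancelʳ-≤ _ _ _ (≤-trans (≤-reflexive (potential-shift-head H))
  (+-monoʳ-≤ (potential H) (count-mono {G = H ⟨ true ⟩ ⟨ false ⟩} λ S → ∧-conicalˡ _ _)))
potential-shift-≤ {suc n} (suc i) H = +-mono-≤
  (+-mono-≤ (potential-shift-≤ i (H ⟨ false ⟩)) (potential-shift-≤ i (H ⟨ true ⟩)))
  (≤-reflexive (cong (n *_) (count-shift i (H ⟨ true ⟩))))

HeadStable : Fam n → Set
HeadStable {zero}        H = Unit
HeadStable {suc zero}    H = Unit
HeadStable {suc (suc n)} H = H ⟨ true ⟩ ⟨ false ⟩ ⊑ H ⟨ false ⟩ ⟨ true ⟩

-- Closure under moving an element to the next smaller position when that is free, after any prefix;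
-- the recursion lets slices inherit it.
Stable : Fam n → Set
Stable {zero}  H = Unit
Stable {suc n} H = HeadStable H × Stable (H ⟨ false ⟩) × Stable (H ⟨ true ⟩)

-- If no shift lowers the potential, `potential-shift-head` forces the intersection of the two mixed
-- slices to be all of the first, which is head stability. Index `suc i` shifts both slices at once,
-- so each slice is minimal too.
stable : (H : Fam n) → (∀ i → potential H ≤ potential (shift i H)) → Stable H
stable {zero}  H min = tt
stable {suc n} H min = head H min , stable (H ⟨ false ⟩) (proj₁ ∘ tails) , stable (H ⟨ true ⟩) (proj₂ ∘ tails)
  where
  tails : ∀ i → potential (H ⟨ false ⟩) ≤ potential (shift i (H ⟨ false ⟩))
              × potential (H ⟨ true ⟩) ≤ potential (shift i (H ⟨ true ⟩))
  tails i = +-tight (potential-shift-≤ i (H ⟨ false ⟩)) (potential-shift-≤ i (H ⟨ true ⟩))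
    (+-cancelʳ-≤ (n * count (H ⟨ true ⟩)) _ _ (≤-trans (min (suc i))
      (≤-reflexive (cong (λ c → potential (shift i (H ⟨ false ⟩)) + potential (shift i (H ⟨ true ⟩)) + n * c) (count-shift i (H ⟨ true ⟩))))))
  head : ∀ {n} (H : Fam (suc n)) → (∀ i → potential H ≤ potential (shift i H)) → HeadStable H
  head {zero}  H min = tt
  head {suc n} H min S S∈H = ∧-conicalʳ (H (true ∷ false ∷ S)) _
    (⊑-of-count {H = H ⟨ true ⟩ ⟨ false ⟩ ∩ᶠ H ⟨ false ⟩ ⟨ true ⟩} {H ⟨ true ⟩ ⟨ false ⟩} (λ T → ∧-conicalˡ _ _)
      (+-cancelˡ-≤ (potential H) _ _ (≤-trans (+-monoˡ-≤ _ (min zero)) (≤-reflexive (potential-shift-head H)))) S S∈H)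

-- Shadows of cross-intersecting families

-- Choosing the topmost position outside S ∪ T keeps the counts of all suffixes below their length:
-- every position above it already lies in S or T.
push : ∀ {n} {H : Fam (suc n)} → Stable H → (S T : Subset n) → (true ∷ S) ∈ᶠ H → CrossBallot S T → ∣ S ∣ + ∣ T ∣ < n →
  ∃ λ S′ → (false ∷ S′) ∈ᶠ H × ∣ S′ ∣ ≡ suc ∣ S ∣ × CrossBallot S′ T
push {suc n} (headStable , _) (false ∷ S) (false ∷ T) S∈H (_ , bal) lt =
  true ∷ S , headStable S S∈H , refl , lt , bal
push {suc n} {H} (headStable , stable₀ , _) (false ∷ S) (true ∷ T) S∈H (_ , bal) lt
  with push stable₀ S T (headStable S S∈H) bal (s≤s⁻¹ (subst (_< suc n) (+-suc ∣ S ∣ ∣ T ∣) lt))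
... | S′ , S′∈H , size , bal′ = false ∷ S′ , S′∈H , size , subst (λ s → s + suc ∣ T ∣ ≤ suc n) (sym size) lt , bal′
push {suc n} {H} (headStable , _ , stable₁) (true ∷ S) (b ∷ T) S∈H (_ , bal) lt
  -- The next position is occupied: its element is pushed on first, and the head element then moves
  -- into the gap.
  with push stable₁ S T S∈H bal (≤-<-trans (+-monoʳ-≤ ∣ S ∣ (∣p∣≤∣x∷p∣ b T)) (s≤s⁻¹ lt))
... | S′ , S′∈H , size , bal′ =
  true ∷ S′ , headStable S′ S′∈H , cong suc size , subst (λ s → suc s + ∣ b ∷ T ∣ ≤ suc n) (sym size) lt , bal′

-- A disjoint pair is built from the head downwards. Where both sets contain the head, the ballot
-- inequality leaves room to `push` that element of `S` to a position outside both tails, while `T`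
-- stays fixed.
stable-not-cross : ∀ {n} {H G : Fam n} → Stable H → Stable G → Cross H G →
  (S T : Subset n) → S ∈ᶠ H → T ∈ᶠ G → ¬ CrossBallot S T
stable-not-cross {zero} stH stG cr [] [] S∈H T∈G bal = cr refl S∈H T∈G
stable-not-cross {suc n} {H} {G} (_ , stH₀ , _) (_ , stG₀ , _) cr (false ∷ S) (false ∷ T) S∈H T∈G (_ , bal) =
  stable-not-cross stH₀ stG₀ (cross-slice {H = H} {G} refl cr) S T S∈H T∈G bal
stable-not-cross {suc n} {H} {G} (_ , stH₀ , _) (_ , _ , stG₁) cr (false ∷ S) (true ∷ T) S∈H T∈G (_ , bal) =
  stable-not-cross stH₀ stG₁ (cross-slice {H = H} {G} refl cr) S T S∈H T∈G bal
stable-not-cross {suc n} {H} {G} (_ , _ , stH₁) (_ , stG₀ , _) cr (true ∷ S) (false ∷ T) S∈H T∈G (_ , bal) =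
  stable-not-cross stH₁ stG₀ (cross-slice {H = H} {G} refl cr) S T S∈H T∈G bal
stable-not-cross {suc n} {H} {G} stH@(_ , stH₀ , _) (_ , _ , stG₁) cr (true ∷ S) (true ∷ T) S∈H T∈G (le , bal)
  with push stH S T S∈H bal (subst (_≤ n) (+-suc ∣ S ∣ ∣ T ∣) (s≤s⁻¹ le))
... | S′ , S′∈H , _ , bal′ = stable-not-cross stH₀ stG₁ (cross-slice {H = H} {G} refl cr) S′ T S′∈H T∈G bal′

-- The inequality at each suffix is the average of the two given ones.
crossBallot-of-ballots : (S T : Subset n) → CrossBallot S S → CrossBallot T T → CrossBallot S T
crossBallot-of-ballots []      []      _ _ = tt
crossBallot-of-ballots {suc n} (a ∷ S) (b ∷ T) (p , bS) (q , bT) =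
  *-cancelˡ-≤ 2 (≤-trans (≤-reflexive (regroup ∣ a ∷ S ∣ ∣ b ∷ T ∣)) (≤-trans (+-mono-≤ p q) (≤-reflexive (double (suc n))))) , crossBallot-of-ballots S T bS bT
  where
  regroup : ∀ s t → 2 * (s + t) ≡ (s + s) + (t + t)
  regroup = solve-∀
  double : ∀ s → s + s ≡ 2 * s
  double = solve-∀

noBallot-or-∃ : (H : Fam n) → (∀ S → S ∈ᶠ H → ¬ CrossBallot S S) ⊎ (∃ λ S → S ∈ᶠ H × CrossBallot S S)
noBallot-or-∃ H with anySubset? (λ S → (H S Bool.≟ true) ×-dec crossBallot? S S)
... | yes found = inj₂ found
... | no  none  = inj₁ λ S S∈H bal → none (S , S∈H , bal)

shadow-cross-stable : {H G : Fam n} → Stable H → Stable G → Uniform m H → Uniform m G → Cross H G →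
  count H ≤ count (∂ H) ⊎ count G ≤ count (∂ G)
shadow-cross-stable {H = H} {G} stH stG uH uG cr with noBallot-or-∃ H | noBallot-or-∃ G
... | inj₁ nb | _       = inj₁ (shadow-noBallot uH nb)
... | _       | inj₁ nb = inj₂ (shadow-noBallot uG nb)
... | inj₂ (S , S∈H , bS) | inj₂ (T , T∈G , bT) =
  contradiction (crossBallot-of-ballots S T bS bT) (stable-not-cross stH stG cr S T S∈H T∈G)

-- Induction on the total potential. A simultaneous shift preserves counts and does not enlarge
-- shadows, so the conclusion carries back. If no shift lowers the total, neither potential can drop
-- alone, and both families are stable.
shadow-cross : {H G : Fam n} → Uniform m H → Uniform m G → Cross H G →
  count H ≤ count (∂ H) ⊎ count G ≤ count (∂ G)
shadow-cross {n} {m} {H} {G} = go H G (<-wellFounded _)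
  where
  total : Fam n → Fam n → ℕ
  total H G = potential H + potential G
  go : ∀ H G → Acc _<_ (total H G) → Uniform m H → Uniform m G → Cross H G →
    count H ≤ count (∂ H) ⊎ count G ≤ count (∂ G)
  go H G (acc rec) uH uG cr with any? (λ i → total (shift i H) (shift i G) <? total H G)
  ... | yes (i , lt) with go (shift i H) (shift i G) (rec lt) (uniform-shift i uH) (uniform-shift i uG) (cross-shift i {H} {G} cr)
  ...   | inj₁ le = inj₁ (≤-trans (≤-reflexive (sym (count-shift i H))) (≤-trans le (count-∂-shift i H)))
  ...   | inj₂ le = inj₂ (≤-trans (≤-reflexive (sym (count-shift i G))) (≤-trans le (count-∂-shift i G)))
  go H G (acc rec) uH uG cr | no none =
    shadow-cross-stable (stable H (proj₁ ∘ tight)) (stable G (proj₂ ∘ tight)) uH uG cr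
    where
    tight : ∀ i → potential H ≤ potential (shift i H) × potential G ≤ potential (shift i G)
    tight i = +-tight (potential-shift-≤ i H) (potential-shift-≤ i G) (≮⇒≥ (none ∘ (i ,_)))

-- Agreement of the enumerated and the recursive notions

length-filterᵇ-map : {B : Set} (p : B → Bool) (f : A → B) (xs : List A) →
  length (filterᵇ p (map f xs)) ≡ length (filterᵇ (p ∘ f) xs)
length-filterᵇ-map p f [] = refl
length-filterᵇ-map p f (x ∷ xs) with p (f x)
... | true  = cong suc (length-filterᵇ-map p f xs)
... | false = length-filterᵇ-map p f xs

card≡count : (H : Fam n) → card H ≡ count H
card≡count {zero} H with H []
... | true  = refl
... | false = refl
card≡count {suc n} H = begin
  length (filterᵇ H (map (false ∷_) Ss ++ map (true ∷_) Ss))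
    ≡⟨ cong length (filter-++ (T? ∘ H) (map (false ∷_) Ss) _) ⟩
  length (filterᵇ H (map (false ∷_) Ss) ++ filterᵇ H (map (true ∷_) Ss))
    ≡⟨ length-++ (filterᵇ H (map (false ∷_) Ss)) ⟩
  length (filterᵇ H (map (false ∷_) Ss)) + length (filterᵇ H (map (true ∷_) Ss))
    ≡⟨ cong₂ _+_ (length-filterᵇ-map H (false ∷_) Ss) (length-filterᵇ-map H (true ∷_) Ss) ⟩
  card (H ⟨ false ⟩) + card (H ⟨ true ⟩)
    ≡⟨ cong₂ _+_ (card≡count (H ⟨ false ⟩)) (card≡count (H ⟨ true ⟩)) ⟩
  count H ∎
  where
  open ≡-Reasoning
  Ss = allSubsets n

∈-allSubsets : (S : Subset n) → S ∈ₗ allSubsets n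
∈-allSubsets []          = here refl
∈-allSubsets (false ∷ S) = ∈-++⁺ˡ (∈-map⁺ (false ∷_) (∈-allSubsets S))
∈-allSubsets {suc n} (true ∷ S) = ∈-++⁺ʳ (map (false ∷_) (allSubsets n)) (∈-map⁺ (true ∷_) (∈-allSubsets S))

any-true⁻ : (p : A → Bool) (xs : List A) → any p xs ≡ true → ∃ λ x → p x ≡ true
any-true⁻ p xs e = map₂ (Equivalence.to T-≡) (satisfied (any⁻ p xs (Equivalence.from T-≡ e)))

any-true⁺ : (p : A → Bool) {x : A} {xs : List A} → x ∈ₗ xs → p x ≡ true → any p xs ≡ true
any-true⁺ p x∈xs e = Equivalence.to T-≡ (any⁺ p (loseₗ x∈xs (Equivalence.from T-≡ e)))

⌊⌋-true⁻ : {P : Set} (P? : Dec P) → ⌊ P? ⌋ ≡ true → P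
⌊⌋-true⁻ (yes p) _ = p

⌊⌋-true⁺ : {P : Set} (P? : Dec P) → P → ⌊ P? ⌋ ≡ true
⌊⌋-true⁺ (yes _) _ = refl
⌊⌋-true⁺ (no ¬p) p = contradiction p ¬p

==-true⁺ : (S T : Subset n) → S ≡ T → (S == T) ≡ true
==-true⁺ S T = ⌊⌋-true⁺ _

∂-intro : (H : Fam n) {T : Subset n} {x : Fin n} → T ∈ᶠ H → x ∈ T → (T - x) ∈ᶠ ∂ H
∂-intro H {true ∷ T} {zero} T∈H here =
  subst (λ S → ∂ H (false ∷ S) ≡ true) (sym (p─⊥≡p T)) (∨-true⁺ (∂ (H ⟨ false ⟩) T) (inj₂ T∈H))
∂-intro H {true ∷ T} {suc x} T∈H (there x∈T) = ∂-intro (H ⟨ true ⟩) T∈H x∈T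
∂-intro H {false ∷ T} {suc x} T∈H (there x∈T) = ∨-true⁺ _ (inj₁ (∂-intro (H ⟨ false ⟩) T∈H x∈T))

∂-elim : (H : Fam n) (S : Subset n) → S ∈ᶠ ∂ H → ∃ λ T → ∃ λ x → T ∈ᶠ H × x ∈ T × T - x ≡ S
∂-elim {suc n} H (true ∷ S) e with ∂-elim (H ⟨ true ⟩) S e
... | T , x , T∈H , x∈T , eq = true ∷ T , suc x , T∈H , there x∈T , cong (true ∷_) eq
∂-elim {suc n} H (false ∷ S) e with ∨-true⁻ (∂ (H ⟨ false ⟩) S) e
... | inj₂ S∈H = true ∷ S , zero , S∈H , here , cong (false ∷_) (p─⊥≡p S)
... | inj₁ e′ with ∂-elim (H ⟨ false ⟩) S e′
...   | T , x , T∈H , x∈T , eq = false ∷ T , suc x , T∈H , there x∈T , cong (false ∷_) eq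

shadow⊑∂ : (H : Fam n) → shadow H ⊑ ∂ H
shadow⊑∂ {n} H S e with any-true⁻ _ (allSubsets n) e
... | T , e₁ with any-true⁻ _ (allFin n) (∧-conicalʳ (H T) _ e₁)
... | x , e₂ = subst (_∈ᶠ ∂ H) (⌊⌋-true⁻ _ (∧-conicalʳ ⌊ x ∈? T ⌋ _ e₂))
  (∂-intro H (∧-conicalˡ _ _ e₁) (⌊⌋-true⁻ (x ∈? T) (∧-conicalˡ _ _ e₂)))

∂⊑shadow : (H : Fam n) → ∂ H ⊑ shadow H
∂⊑shadow {n} H S e with ∂-elim H S e
... | T , x , T∈H , x∈T , eq = any-true⁺ _ (∈-allSubsets T) (cong₂ _∧_ T∈H
  (any-true⁺ _ (∈-allFin x) (cong₂ _∧_ (⌊⌋-true⁺ (x ∈? T) x∈T) (⌊⌋-true⁺ _ eq))))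

card-shadow : (H : Fam n) → card (shadow H) ≡ count (∂ H)
card-shadow H = trans (card≡count (shadow H)) (≤-antisym (count-mono (shadow⊑∂ H)) (count-mono (∂⊑shadow H)))

-- Disjoint sets and links

Disjoint : Subset n → Subset n → Set
Disjoint S T = ∀ {x} → x ∈ S → x ∉ T

disjoint⁺ : {S T : Subset n} → S ∩ T ≡ ⊥ → Disjoint S T
disjoint⁺ eq x∈S x∈T = ∉⊥ (subst (_ ∈_) eq (x∈p∩q⁺ (x∈S , x∈T)))

disjoint⁻ : {S T : Subset n} → Disjoint S T → S ∩ T ≡ ⊥
disjoint⁻ {S = S} {T} dis = Empty-unique λ { (x , x∈) → let x∈S , x∈T = x∈p∩q⁻ S T x∈ in dis x∈S x∈T }

x∈p─q⁻ : {S A : Subset n} {x : Fin n} → x ∈ S ─ A → x ∉ A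
x∈p─q⁻ {S = s ∷ S} {true ∷ A}  (there x∈) (there x∈A) = x∈p─q⁻ x∈ x∈A
x∈p─q⁻ {S = s ∷ S} {false ∷ A} (there x∈) (there x∈A) = x∈p─q⁻ x∈ x∈A

[p─q]∪q≡p : (T A : Subset n) → A ⊆ T → (T ─ A) ∪ A ≡ T
[p─q]∪q≡p []      []          A⊆T = refl
[p─q]∪q≡p (t ∷ T) (false ∷ A) A⊆T = cong₂ _∷_ (Bool.∨-identityʳ t) ([p─q]∪q≡p T A (drop-∷-⊆ A⊆T))
[p─q]∪q≡p (t ∷ T) (true ∷ A)  A⊆T with A⊆T here
... | here = cong (true ∷_) ([p─q]∪q≡p T A (drop-∷-⊆ A⊆T))

drop-∷-Disjoint : ∀ {a b} {S T : Subset n} → Disjoint (a ∷ S) (b ∷ T) → Disjoint S T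
drop-∷-Disjoint dis x∈S x∈T = dis (there x∈S) (there x∈T)

[p∪q]─q≡p : (S A : Subset n) → Disjoint S A → (S ∪ A) ─ A ≡ S
[p∪q]─q≡p []      []          dis = refl
[p∪q]─q≡p (s ∷ S) (false ∷ A) dis = cong₂ _∷_ (Bool.∨-identityʳ s) ([p∪q]─q≡p S A (drop-∷-Disjoint dis))
[p∪q]─q≡p (true ∷ S)  (true ∷ A) dis = contradiction here (dis here)
[p∪q]─q≡p (false ∷ S) (true ∷ A) dis = cong (false ∷_) ([p∪q]─q≡p S A (drop-∷-Disjoint dis))

∣p∪q∣≡∣p∣+∣q∣ : (S A : Subset n) → Disjoint S A → ∣ S ∪ A ∣ ≡ ∣ S ∣ + ∣ A ∣
∣p∪q∣≡∣p∣+∣q∣ []          []          dis = refl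
∣p∪q∣≡∣p∣+∣q∣ (true ∷ S)  (true ∷ A)  dis = contradiction here (dis here)
∣p∪q∣≡∣p∣+∣q∣ (true ∷ S)  (false ∷ A) dis = cong suc (∣p∪q∣≡∣p∣+∣q∣ S A (drop-∷-Disjoint dis))
∣p∪q∣≡∣p∣+∣q∣ (false ∷ S) (true ∷ A)  dis =
  trans (cong suc (∣p∪q∣≡∣p∣+∣q∣ S A (drop-∷-Disjoint dis))) (sym (+-suc ∣ S ∣ ∣ A ∣))
∣p∪q∣≡∣p∣+∣q∣ (false ∷ S) (false ∷ A) dis = ∣p∪q∣≡∣p∣+∣q∣ S A (drop-∷-Disjoint dis)

linkAvoid : Fam n → Subset n → Subset n → Fam n
linkAvoid F A X = avoid (linkOf F A) X

-- The witness `T` contains `A`, so it is recovered from `S = T ─ A` as `S ∪ A`.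
linkAvoid⁻ : (F : Fam n) (A X S : Subset n) → S ∈ᶠ linkAvoid F A X → Disjoint S A × (S ∪ A) ∈ᶠ F × Disjoint S X
linkAvoid⁻ {n} F A X S e with any-true⁻ _ (allSubsets n) (∧-conicalˡ _ _ e)
... | T , e₁ with ∧-conicalʳ (F T) _ e₁
... | e₂ with ∧-conicalʳ ((⊥ ∩ T) == ⊥) _ (∧-conicalʳ ⌊ A ⊆? T ⌋ _ e₂)
... | e₃ with ⌊⌋-true⁻ _ e₃
... | refl = x∈p─q⁻ {S = T}
  , subst (_∈ᶠ F) (sym ([p─q]∪q≡p T A (⌊⌋-true⁻ (A ⊆? T) (∧-conicalˡ _ _ e₂)))) (∧-conicalˡ _ _ e₁)
  , disjoint⁺ (⌊⌋-true⁻ _ (∧-conicalʳ (linkOf F A S) _ e))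

linkAvoid⁺ : (F : Fam n) (A X S : Subset n) → Disjoint S A → (S ∪ A) ∈ᶠ F → Disjoint S X → S ∈ᶠ linkAvoid F A X
linkAvoid⁺ {n} F A X S S⊥A S∪A∈F S⊥X = cong₂ _∧_
  (any-true⁺ _ (∈-allSubsets (S ∪ A)) (cong₂ _∧_ S∪A∈F (cong₂ _∧_ (⌊⌋-true⁺ (A ⊆? (S ∪ A)) (q⊆p∪q S A))
    (cong₂ _∧_ (==-true⁺ (⊥ ∩ (S ∪ A)) ⊥ (∩-zeroˡ (S ∪ A))) (==-true⁺ ((S ∪ A) ─ A) S ([p∪q]─q≡p S A S⊥A))))))
  (⌊⌋-true⁺ _ (disjoint⁻ S⊥X))

-- Splitting a family at an element

-- This and `contract` keep the ground set, with `b` in no member, so that the results can be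
-- compared with links of `F`.
delete : Fin n → Fam n → Fam n
delete zero    P (false ∷ S) = P (false ∷ S)
delete zero    P (true ∷ S)  = false
delete (suc b) P (a ∷ S)     = delete b (P ⟨ a ⟩) S

contract : Fin n → Fam n → Fam n
contract zero    P (false ∷ S) = P (true ∷ S)
contract zero    P (true ∷ S)  = false
contract (suc b) P (a ∷ S)     = contract b (P ⟨ a ⟩) S

delete⁻ : (b : Fin n) (P : Fam n) (S : Subset n) → S ∈ᶠ delete b P → S ∈ᶠ P × b ∉ S
delete⁻ zero    P (false ∷ S) e = e , λ ()
delete⁻ (suc b) P (a ∷ S)     e with delete⁻ b (P ⟨ a ⟩) S e
... | S∈P , b∉S = S∈P , b∉S ∘ drop-there

delete⁺ : (b : Fin n) (P : Fam n) (S : Subset n) → S ∈ᶠ P → b ∉ S → S ∈ᶠ delete b P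
delete⁺ zero    P (false ∷ S) S∈P b∉S = S∈P
delete⁺ zero    P (true ∷ S)  S∈P b∉S = contradiction here b∉S
delete⁺ (suc b) P (a ∷ S)     S∈P b∉S = delete⁺ b (P ⟨ a ⟩) S S∈P (b∉S ∘ there)

contract⁻ : (b : Fin n) (P : Fam n) (S : Subset n) → S ∈ᶠ contract b P → (S ∪ ⁅ b ⁆) ∈ᶠ P × b ∉ S
contract⁻ {suc n} zero P (false ∷ S) e = subst (λ T → P (true ∷ T) ≡ true) (sym (∪-identityʳ S)) e , λ ()
contract⁻ (suc b) P (a ∷ S)     e with contract⁻ b (P ⟨ a ⟩) S e
... | S∈P , b∉S = subst (λ c → P (c ∷ (S ∪ ⁅ b ⁆)) ≡ true) (sym (Bool.∨-identityʳ a)) S∈P , b∉S ∘ drop-there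

contract⁺ : (b : Fin n) (P : Fam n) (S : Subset n) → (S ∪ ⁅ b ⁆) ∈ᶠ P → b ∉ S → S ∈ᶠ contract b P
contract⁺ {suc n} zero P (false ∷ S) S∈P b∉S = subst (λ T → P (true ∷ T) ≡ true) (∪-identityʳ S) S∈P
contract⁺ zero    P (true ∷ S)  S∈P b∉S = contradiction here b∉S
contract⁺ (suc b) P (a ∷ S)     S∈P b∉S = contract⁺ b (P ⟨ a ⟩) S
  (subst (λ c → P (c ∷ (S ∪ ⁅ b ⁆)) ≡ true) (Bool.∨-identityʳ a) S∈P) (b∉S ∘ there)

count-split : (b : Fin n) (P : Fam n) → count P ≡ count (delete b P) + count (contract b P)
count-split {suc n} zero P = sym (cong₂ _+_ (drop (P ⟨ false ⟩)) (drop (P ⟨ true ⟩)))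
  where
  drop : (Q : Fam n) → count Q + count {n} (λ _ → false) ≡ count Q
  drop Q = trans (cong (count Q +_) (count-empty {n} λ _ ())) (+-identityʳ (count Q))
count-split {suc n} (suc b) P = trans (cong₂ _+_ (count-split b (P ⟨ false ⟩)) (count-split b (P ⟨ true ⟩)))
  (+-interchange (count (delete b (P ⟨ false ⟩))) _ _ _)

∂-empty : (S : Subset n) → ¬ S ∈ᶠ ∂ (λ _ → false)
∂-empty S e with ∂-elim (λ _ → false) S e
... | _ , _ , () , _

∂-delete : (b : Fin n) (P : Fam n) → ∂ (delete b P) ⊑ delete b (∂ P)
∂-delete zero P (false ∷ S) e = [ ∨-true⁺ _ ∘ inj₁ , (λ ()) ]′ (∨-true⁻ (∂ (P ⟨ false ⟩) S) e)
∂-delete zero P (true ∷ S)  e = contradiction e (∂-empty S)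
∂-delete (suc b) P (true ∷ S) e = ∂-delete b (P ⟨ true ⟩) S e
∂-delete (suc b) P (false ∷ S) e with ∨-true⁻ (∂ (delete b (P ⟨ false ⟩)) S) e
... | inj₁ p = let q , b∉S = delete⁻ b (∂ (P ⟨ false ⟩)) S (∂-delete b (P ⟨ false ⟩) S p)
               in delete⁺ b (∂ P ⟨ false ⟩) S (∨-true⁺ _ (inj₁ q)) b∉S
... | inj₂ p = let q , b∉S = delete⁻ b (P ⟨ true ⟩) S p
               in delete⁺ b (∂ P ⟨ false ⟩) S (∨-true⁺ (∂ (P ⟨ false ⟩) S) (inj₂ q)) b∉S

∂-contract : (b : Fin n) (P : Fam n) → ∂ (contract b P) ⊑ contract b (∂ P)
∂-contract zero P (false ∷ S) e = [ id , (λ ()) ]′ (∨-true⁻ (∂ (P ⟨ true ⟩) S) e)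
∂-contract zero P (true ∷ S)  e = contradiction e (∂-empty S)
∂-contract (suc b) P (true ∷ S) e = ∂-contract b (P ⟨ true ⟩) S e
∂-contract (suc b) P (false ∷ S) e with ∨-true⁻ (∂ (contract b (P ⟨ false ⟩)) S) e
... | inj₁ p = let q , b∉S = contract⁻ b (∂ (P ⟨ false ⟩)) S (∂-contract b (P ⟨ false ⟩) S p)
               in contract⁺ b (∂ P ⟨ false ⟩) S (∨-true⁺ _ (inj₁ q)) b∉S
... | inj₂ p = let q , b∉S = contract⁻ b (P ⟨ true ⟩) S p
               in contract⁺ b (∂ P ⟨ false ⟩) S (∨-true⁺ (∂ (P ⟨ false ⟩) (S ∪ ⁅ b ⁆)) (inj₂ q)) b∉S

-- Deficient links

Deficient : Fam n → Set
Deficient H = count (∂ H) < count H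

deficient-resp : {H G : Fam n} → H ⊑ G → G ⊑ H → Deficient H → Deficient G
deficient-resp H⊑G G⊑H lt = ≤-<-trans (count-mono (∂-mono G⊑H)) (<-≤-trans lt (count-mono H⊑G))

-- The shadows of the two pieces embed in the corresponding pieces of `∂ P`, which do not overlap.
-- If contraction has a large enough shadow, the deficit must come from deletion.
deficient-delete : (b : Fin n) (P : Fam n) → Deficient P → ¬ Deficient (contract b P) → Deficient (delete b P)
deficient-delete b P lt contract-ok = +-cancelʳ-< (count (contract b P)) _ _ (begin-strict
  count (∂ (delete b P)) + count (contract b P)       ≤⟨ +-monoʳ-≤ _ (≮⇒≥ contract-ok) ⟩
  count (∂ (delete b P)) + count (∂ (contract b P))   ≤⟨ +-mono-≤ (count-mono (∂-delete b P)) (count-mono (∂-contract b P)) ⟩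
  count (delete b (∂ P)) + count (contract b (∂ P))   ≡⟨ count-split b (∂ P) ⟨
  count (∂ P)                                         <⟨ lt ⟩
  count P                                             ≡⟨ count-split b P ⟩
  count (delete b P) + count (contract b P)           ∎)
  where open ≤-Reasoning

NeverDeficient : Fam n → Subset n → Set
NeverDeficient F A = ∀ X → ¬ Deficient (linkAvoid F A X)

module _ (F : Fam n) where

  [p∪q]∪r : (S B A : Subset n) → (S ∪ B) ∪ A ≡ S ∪ (A ∪ B)
  [p∪q]∪r S B A = trans (∪-assoc S B A) (cong (S ∪_) (∪-comm B A))

  -- Contracting F(A) restricted to sets avoiding `X` at `b` gives the same restriction of F(A ∪
  -- {b}), which is not deficient by `ok`; deleting `b` amounts to avoiding `b` as well.
  avoid-one-more : ∀ A X b → b ∉ A → b ∉ X → NeverDeficient F (A ∪ ⁅ b ⁆) →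
    Deficient (linkAvoid F A X) → Deficient (linkAvoid F A (X ∪ ⁅ b ⁆))
  avoid-one-more A X b b∉A b∉X ok lt =
    deficient-resp del⊑ ⊑del (deficient-delete b (linkAvoid F A X) lt (ok X ∘ deficient-resp con⊑ ⊑con))
    where
    ∪b-disjoint : {S Y : Subset n} → b ∉ Y → Disjoint S Y → Disjoint (S ∪ ⁅ b ⁆) Y
    ∪b-disjoint {S} b∉Y dis x∈ x∈Y with x∈p∪q⁻ S ⁅ b ⁆ x∈
    ... | inj₁ x∈S = dis x∈S x∈Y
    ... | inj₂ x∈b = b∉Y (subst (_∈ _) (x∈⁅y⁆⇒x≡y b x∈b) x∈Y)
    disjoint-∪b : {S Y : Subset n} → b ∉ S → Disjoint S Y → Disjoint S (Y ∪ ⁅ b ⁆)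
    disjoint-∪b {S} {Y} b∉S dis x∈S x∈ with x∈p∪q⁻ Y ⁅ b ⁆ x∈
    ... | inj₁ x∈Y = dis x∈S x∈Y
    ... | inj₂ x∈b = b∉S (subst (_∈ S) (x∈⁅y⁆⇒x≡y b x∈b) x∈S)
    avoids-b : {S Y : Subset n} → Disjoint S (Y ∪ ⁅ b ⁆) → b ∉ S
    avoids-b {Y = Y} dis b∈S = dis b∈S (q⊆p∪q Y ⁅ b ⁆ (x∈⁅x⁆ b))
    del⊑ : delete b (linkAvoid F A X) ⊑ linkAvoid F A (X ∪ ⁅ b ⁆)
    del⊑ S e = let S∈ , b∉S = delete⁻ b (linkAvoid F A X) S e
                   S⊥A , S∪A∈F , S⊥X = linkAvoid⁻ F A X S S∈
               in linkAvoid⁺ F A (X ∪ ⁅ b ⁆) S S⊥A S∪A∈F (disjoint-∪b b∉S S⊥X)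
    ⊑del : linkAvoid F A (X ∪ ⁅ b ⁆) ⊑ delete b (linkAvoid F A X)
    ⊑del S e = let S⊥A , S∪A∈F , S⊥X∪b = linkAvoid⁻ F A (X ∪ ⁅ b ⁆) S e
               in delete⁺ b (linkAvoid F A X) S
                    (linkAvoid⁺ F A X S S⊥A S∪A∈F (λ x∈S x∈X → S⊥X∪b x∈S (p⊆p∪q ⁅ b ⁆ x∈X)))
                    (avoids-b {Y = X} S⊥X∪b)
    con⊑ : contract b (linkAvoid F A X) ⊑ linkAvoid F (A ∪ ⁅ b ⁆) X
    con⊑ S e = let S∪b∈ , b∉S = contract⁻ b (linkAvoid F A X) S e
                   dA , ∈F , dX = linkAvoid⁻ F A X (S ∪ ⁅ b ⁆) S∪b∈
               in linkAvoid⁺ F (A ∪ ⁅ b ⁆) X S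
                    (disjoint-∪b b∉S (dA ∘ p⊆p∪q ⁅ b ⁆))
                    (subst (_∈ᶠ F) ([p∪q]∪r S ⁅ b ⁆ A) ∈F)
                    (dX ∘ p⊆p∪q ⁅ b ⁆)
    ⊑con : linkAvoid F (A ∪ ⁅ b ⁆) X ⊑ contract b (linkAvoid F A X)
    ⊑con S e = let dA , ∈F , dX = linkAvoid⁻ F (A ∪ ⁅ b ⁆) X S e
               in contract⁺ b (linkAvoid F A X) S
                    (linkAvoid⁺ F A X (S ∪ ⁅ b ⁆)
                      (∪b-disjoint b∉A (λ x∈S x∈A → dA x∈S (p⊆p∪q ⁅ b ⁆ x∈A)))
                      (subst (_∈ᶠ F) (sym ([p∪q]∪r S ⁅ b ⁆ A)) ∈F)
                      (∪b-disjoint b∉X dX))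
                    (avoids-b {Y = A} dA)

  -- The elements of `B` join `X` one at a time; those already present are skipped.
  avoid-all : ∀ A B X → Disjoint A B → (∀ b → b ∈ B → NeverDeficient F (A ∪ ⁅ b ⁆)) →
    Deficient (linkAvoid F A X) → ∃ λ X′ → B ⊆ X′ × Deficient (linkAvoid F A X′)
  avoid-all A B X A⊥B ok lt = let X′ , cover , lt′ = go (allFin n) in X′ , (λ {x} → cover x (∈-allFin x)) , lt′
    where
    go : (bs : List (Fin n)) → ∃ λ X′ → (∀ b → b ∈ₗ bs → b ∈ B → b ∈ X′) × Deficient (linkAvoid F A X′)
    go [] = X , (λ _ ()) , lt
    go (b ∷ bs) with go bs
    ... | X′ , cover , lt′ with b ∈? B | b ∈? X′
    ...   | no b∉B | _ = X′ , (λ { _ (here refl) b∈B → contradiction b∈B b∉B ; c (there c∈) → cover c c∈ }) , lt′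
    ...   | yes _ | yes b∈X′ = X′ , (λ { _ (here refl) _ → b∈X′ ; c (there c∈) → cover c c∈ }) , lt′
    ...   | yes b∈B | no b∉X′ = X′ ∪ ⁅ b ⁆
      , (λ { _ (here refl) _ → q⊆p∪q X′ ⁅ b ⁆ (x∈⁅x⁆ b) ; c (there c∈) c∈B → p⊆p∪q ⁅ b ⁆ (cover c c∈ c∈B) })
      , avoid-one-more A X′ b (λ b∈A → A⊥B b∈A b∈B) b∉X′ (ok b b∈B) lt′

  Level : Subset n → ℕ → Set
  Level M i = ∀ A → A ⊆ M → ∣ A ∣ ≡ i → NeverDeficient F A

  module _ {k : ℕ} (uniform : Uniform k F) (intersecting : Intersecting F) where

    linkAvoid-uniform : ∀ {i} A X → ∣ A ∣ ≡ i → Uniform (k ∸ i) (linkAvoid F A X)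
    linkAvoid-uniform A X refl S S∈ = let S⊥A , S∪A∈F , _ = linkAvoid⁻ F A X S S∈ in
      trans (sym (m+n∸n≡m ∣ S ∣ ∣ A ∣)) (cong (_∸ ∣ A ∣) (trans (sym (∣p∪q∣≡∣p∣+∣q∣ S A S⊥A)) (uniform _ S∪A∈F)))

    -- Once `X′` covers `B` and `Y′` covers `A`, a common element of `S ∪ A` and `T ∪ B` can only
    -- lie in both `S` and `T`. So the two links are cross-intersecting, and `shadow-cross` rules
    -- out two deficits.
    not-both-deficient : ∀ {M i} → Level M (suc i) → ∀ A B → A ⊆ M → B ⊆ M → ∣ A ∣ ≡ i → ∣ B ∣ ≡ i → Disjoint A B →
      ∀ X Y → Deficient (linkAvoid F A X) → ¬ Deficient (linkAvoid F B Y)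
    not-both-deficient {M} {i} level A B A⊆M B⊆M ∣A∣ ∣B∣ A⊥B X Y ltA ltB
      with avoid-all A B X A⊥B (extend A B A⊆M B⊆M ∣A∣ A⊥B) ltA | avoid-all B A Y B⊥A (extend B A B⊆M A⊆M ∣B∣ B⊥A) ltB
      where
      B⊥A : Disjoint B A
      B⊥A x∈B x∈A = A⊥B x∈A x∈B
      extend : ∀ A B → A ⊆ M → B ⊆ M → ∣ A ∣ ≡ i → Disjoint A B → ∀ b → b ∈ B → NeverDeficient F (A ∪ ⁅ b ⁆)
      extend A B A⊆M B⊆M ∣A∣ A⊥B b b∈B = level (A ∪ ⁅ b ⁆)
        ([ A⊆M , (λ x∈b → subst (_∈ M) (sym (x∈⁅y⁆⇒x≡y b x∈b)) (B⊆M b∈B)) ]′ ∘ x∈p∪q⁻ A ⁅ b ⁆)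
        (trans (∣p∪q∣≡∣p∣+∣q∣ A ⁅ b ⁆ (λ x∈A x∈b → A⊥B x∈A (subst (_∈ B) (sym (x∈⁅y⁆⇒x≡y b x∈b)) b∈B)))
               (trans (cong₂ _+_ ∣A∣ (∣⁅x⁆∣≡1 b)) (+-comm i 1)))
    ... | X′ , B⊆X′ , ltA′ | Y′ , A⊆Y′ , ltB′ =
      [ <⇒≱ ltA′ , <⇒≱ ltB′ ]′ (shadow-cross (linkAvoid-uniform A X′ ∣A∣) (linkAvoid-uniform B Y′ ∣B∣) cross)
      where
      cross : Cross (linkAvoid F A X′) (linkAvoid F B Y′)
      cross {S} {T} S∩T S∈ T∈ with linkAvoid⁻ F A X′ S S∈ | linkAvoid⁻ F B Y′ T T∈
      ... | _ , S∪A∈F , S⊥X′ | _ , T∪B∈F , T⊥Y′ with intersecting (S ∪ A) (T ∪ B) S∪A∈F T∪B∈F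
      ... | x , x∈ with x∈p∩q⁻ (S ∪ A) (T ∪ B) x∈
      ... | x∈S∪A , x∈T∪B with x∈p∪q⁻ S A x∈S∪A | x∈p∪q⁻ T B x∈T∪B
      ... | inj₁ x∈S | inj₁ x∈T = disjoint⁺ S∩T x∈S x∈T
      ... | inj₁ x∈S | inj₂ x∈B = S⊥X′ x∈S (B⊆X′ x∈B)
      ... | inj₂ x∈A | inj₁ x∈T = T⊥Y′ x∈T (A⊆Y′ x∈A)
      ... | inj₂ x∈A | inj₂ x∈B = A⊥B x∈A x∈B

    -- The descending chain of sets

    -- The search for a bad set is decidable and needs no `Level` hypothesis, so the chain can be
    -- defined before its levels are verified.
    step : ∀ M i → ∃ λ M′ → M′ ⊆ M × ∣ M ∣ ≤ ∣ M′ ∣ + i × (Level M (suc i) → Level M′ i)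
    step M i with anySubset? (λ A → A ⊆? M ×-dec (∣ A ∣ ≟ i) ×-dec
                    anySubset? (λ X → count (∂ (linkAvoid F A X)) <? count (linkAvoid F A X)))
    ... | no none = M , id , m≤m+n ∣ M ∣ i , λ _ A A⊆M ∣A∣ X lt → none (A , A⊆M , ∣A∣ , X , lt)
    ... | yes (A , A⊆M , ∣A∣ , X , lt) = M ─ A , p─q⊆p M A , size
      , λ level B B⊆M─A ∣B∣ Y → not-both-deficient level A B A⊆M (p─q⊆p M A ∘ B⊆M─A) ∣A∣ ∣B∣
          (λ x∈A x∈B → x∈p─q⁻ {S = M} (B⊆M─A x∈B) x∈A) X Y lt
      where
      size : ∣ M ∣ ≤ ∣ M ─ A ∣ + i
      size = ≤-reflexive (trans (cong ∣_∣ (sym ([p─q]∪q≡p M A A⊆M)))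
        (trans (∣p∪q∣≡∣p∣+∣q∣ (M ─ A) A (x∈p─q⁻ {S = M})) (cong (∣ M ─ A ∣ +_) ∣A∣)))

    -- Stage `d` is the set of index k + 1 - d: stage 0 is the whole ground set, and the next stage
    -- treats level `k ∸ d`.
    descent : ℕ → Subset n
    descent zero    = ⊤
    descent (suc d) = proj₁ (step (descent d) (k ∸ d))

    descent-level : ∀ d i → d + i ≡ suc k → Level (descent d) i
    -- Level k + 1 is vacuous: no k-set contains k + 1 elements, so the link is empty.
    descent-level zero i refl A _ ∣A∣ X lt = n≮0 (<-≤-trans lt (≤-reflexive (count-empty {H = linkAvoid F A X} λ S S∈ →
      let S⊥A , S∪A∈F , _ = linkAvoid⁻ F A X S S∈
      in <⇒≱ (≤-reflexive (sym ∣A∣)) (≤-trans (∣q∣≤∣p∪q∣ S A) (≤-reflexive (uniform _ S∪A∈F))))))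
    descent-level (suc d) i e = subst (Level (descent (suc d))) k∸d≡i (proj₂ (proj₂ (proj₂ (step (descent d) (k ∸ d))))
      (descent-level d (suc (k ∸ d)) (trans (cong (λ j → d + suc j) k∸d≡i) (trans (+-suc d i) e))))
      where
      k∸d≡i : k ∸ d ≡ i
      k∸d≡i = trans (cong (_∸ d) (suc-injective (sym e))) (m+n∸m≡n d i)

    -- Passing to level `i` costs at most `i` elements, the term split off by `sumFromTo-step`.
    descent-size : ∀ d i → d + i ≡ suc k → n ≤ ∣ descent d ∣ + sumFromTo i k
    descent-size zero    i e = ≤-trans (≤-reflexive (sym (∣⊤∣≡n n))) (m≤m+n _ _)
    descent-size (suc d) i e = begin
      n                                                          ≤⟨ descent-size d (suc i) (trans (+-suc d i) e) ⟩
      ∣ descent d ∣ + sumFromTo (suc i) k                        ≤⟨ +-monoˡ-≤ _ (proj₁ (proj₂ (proj₂ (step (descent d) (k ∸ d))))) ⟩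
      (∣ descent (suc d) ∣ + (k ∸ d)) + sumFromTo (suc i) k      ≡⟨ +-assoc ∣ descent (suc d) ∣ _ _ ⟩
      ∣ descent (suc d) ∣ + ((k ∸ d) + sumFromTo (suc i) k)      ≡⟨ cong (λ j → ∣ descent (suc d) ∣ + (j + sumFromTo (suc i) k)) k∸d≡i ⟩
      ∣ descent (suc d) ∣ + (i + sumFromTo (suc i) k)            ≡⟨ cong (∣ descent (suc d) ∣ +_) (sumFromTo-step i≤k) ⟨
      ∣ descent (suc d) ∣ + sumFromTo i k                        ∎
      where
      open ≤-Reasoning
      k∸d≡i : k ∸ d ≡ i
      k∸d≡i = trans (cong (_∸ d) (suc-injective (sym e))) (m+n∸m≡n d i)
      i≤k : i ≤ k
      i≤k = subst (i ≤_) (suc-injective e) (m≤n+m i d)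

theorem1p6 : (n k : ℕ) → 1 ≤ n → 1 ≤ k → (F : Fam n) → Uniform k F → Intersecting F →
    Σ (ℕ → Subset n) (λ M →
    ((i : ℕ) → 1 ≤ i → i < k → M i ⊆ M (suc i))
    × ((i : ℕ) → 1 ≤ i → i ≤ k → n ≤ ∣ M i ∣ + sumFromTo i k)
    × ((i : ℕ) → 1 ≤ i → i ≤ k → (A : Subset n) → A ⊆ M i → ∣ A ∣ ≡ i →
    PseudoIntersecting (linkOf F A)))
-- The chain is built downwards from k, so the index is reversed.
theorem1p6 n k _ _ F uniform intersecting = (λ i → M (suc k ∸ i)) , nested , large , pseudo
  where
  M = descent F uniform intersecting
  nested : ∀ i → 1 ≤ i → i < k → M (suc k ∸ i) ⊆ M (k ∸ i)
  -- Rewriting `suc k ∸ i` to `suc (k ∸ i)` exposes a single step of the chain.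
  nested i _ i<k rewrite +-∸-assoc 1 (<⇒≤ i<k) =
    proj₁ (proj₂ (step F uniform intersecting (M (k ∸ i)) (k ∸ (k ∸ i))))
  total : ∀ {i} → i ≤ k → (suc k ∸ i) + i ≡ suc k
  total i≤k = m∸n+n≡m (m≤n⇒m≤1+n i≤k)
  large : ∀ i → 1 ≤ i → i ≤ k → n ≤ ∣ M (suc k ∸ i) ∣ + sumFromTo i k
  large i _ i≤k = descent-size F uniform intersecting (suc k ∸ i) i (total i≤k)
  pseudo : ∀ i → 1 ≤ i → i ≤ k → ∀ A → A ⊆ M (suc k ∸ i) → ∣ A ∣ ≡ i → PseudoIntersecting (linkOf F A)
  pseudo i _ i≤k A A⊆M ∣A∣ X = subst₂ _≤_ (sym (card≡count (linkAvoid F A X))) (sym (card-shadow (linkAvoid F A X)))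
    (≮⇒≥ (descent-level F uniform intersecting (suc k ∸ i) i (total i≤k) A A⊆M ∣A∣ X))
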